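{- If $m_4=\tfrac{14}{15}$, then $m_3=\tfrac45$.
   Context: A cubic bridgeless graph is a graph in which every vertex has degree 3 and each connected component is 2-edge-connected. A perfect matching of $G$ is a set of edges such that every vertex is incident to exactly one of them. For a cubic bridgeless graph $G$ and a positive integer $t$, $m_t(G)$ denotes the maximum, over all choices of $t$ perfect matchings $M_1,\dots,M_t$ of $G$, of $|M_1\cup\dots\cup M_t|/|E(G)|$, and $m_t$ denotes the infimum of $m_t(G)$ over all cubic bridgeless graphs $G$. -}

module Defs where

open import Data.Nat using (ℕ; zero; suc; _+_; NonZero)
open import Data.Fin using (Fin; zero; suc; _≟_)
open import Data.Bool using (Bool; true; false; if_then_else_; _∧_; _∨_)
open import Data.Product using (_×_; _,_; proj₁; proj₂; Σ; ∃; ∃-syntax)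
open import Data.Sum using (_⊎_)
open import Data.Integer using (+_)
open import Data.Rational using (ℚ; _/_; _≤_; _<_)
open import Relation.Nullary using (¬_)
open import Relation.Nullary.Decidable using (⌊_⌋)
open import Relation.Binary.PropositionalEquality using (_≡_; _≢_)

count : ∀ {n} → (Fin n → Bool) → ℕ
count {zero}  p = 0
count {suc n} p = (if p zero then 1 else 0) + count (λ k → p (suc k))

anyFin : ∀ {t} → (Fin t → Bool) → Bool
anyFin {zero}  p = false
anyFin {suc t} p = p zero ∨ anyFin (λ i → p (suc i))

record Multigraph : Set where
  field
    n        : ℕ
    m        : ℕ
    ends     : Fin m → Fin n × Fin n
    loopless : ∀ e → proj₁ (ends e) ≢ proj₂ (ends e)

open Multigraph public

incident : (G : Multigraph) → Fin (m G) → Fin (n G) → Bool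
incident G e v = ⌊ proj₁ (ends G e) ≟ v ⌋ ∨ ⌊ proj₂ (ends G e) ≟ v ⌋

degree : (G : Multigraph) → Fin (n G) → ℕ
degree G v = count (λ e → incident G e v)

Cubic : Multigraph → Set
Cubic G = ∀ v → degree G v ≡ 3

data WalkAvoiding (G : Multigraph) (f : Fin (m G)) : Fin (n G) → Fin (n G) → Set where
  here : ∀ {u} → WalkAvoiding G f u u
  step : ∀ {u w v} (e : Fin (m G)) → e ≢ f →
         (ends G e ≡ (u , w) ⊎ ends G e ≡ (w , u)) →
         WalkAvoiding G f w v → WalkAvoiding G f u v

-- no bridge: removing any edge leaves its endpoints connected
-- (equivalently, every connected component is 2-edge-connected)
Bridgeless : Multigraph → Set
Bridgeless G = ∀ e → WalkAvoiding G e (proj₁ (ends G e)) (proj₂ (ends G e))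

record CubicBridgeless : Set where
  field
    graph      : Multigraph
    cubic      : Cubic graph
    bridgeless : Bridgeless graph
    nonempty   : NonZero (m graph)

open CubicBridgeless public

EdgeSet : Multigraph → Set
EdgeSet G = Fin (m G) → Bool

PerfectMatching : (G : Multigraph) → EdgeSet G → Set
PerfectMatching G M = ∀ v → count (λ e → M e ∧ incident G e v) ≡ 1

unionRatio : (H : CubicBridgeless) (t : ℕ) → (Fin t → EdgeSet (graph H)) → ℚ
unionRatio H t Ms =
  _/_ (+ count (λ e → anyFin (λ i → Ms i e))) (m (graph H)) {{nonempty H}}

IsMt : ℕ → CubicBridgeless → ℚ → Set
IsMt t H x =
  (Σ (Fin t → EdgeSet (graph H)) λ Ms →
      (∀ i → PerfectMatching (graph H) (Ms i)) × unionRatio H t Ms ≡ x)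
  × (∀ (Ms : Fin t → EdgeSet (graph H)) →
      (∀ i → PerfectMatching (graph H) (Ms i)) → unionRatio H t Ms ≤ x)

MtEquals : ℕ → ℚ → Set
MtEquals t r =
  (∀ H x → IsMt t H x → r ≤ x)
  × (∀ q → r < q → Σ CubicBridgeless λ H → Σ ℚ λ x → IsMt t H x × x < q)

{-# OPTIONS --safe #-}

-- Given G, replace every edge xy by a copy of the Petersen graph minus an edge pq, attached by
-- new edges xp and qy.  By parity a perfect matching of the resulting graph G′ contains both or none
-- of xp, qy, so it induces a perfect matching of G and, in each copy, one of the six perfect matchings
-- of the Petersen graph.  Take four perfect matchings of G′ covering 14/15 of its edges.  Suppose i of
-- them use the gadget of an edge e of G as if they contained e, and u of the 16 gadget edges are
-- uncovered.  Then the number of triples, out of the four, that leave e uncovered is at most 2u − i.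
-- The average of u is at most 16/15 and that of i is 4/3, so on average a triple leaves at most
-- (32/15 − 4/3)/4 = 1/5 of the edges of G uncovered, hence m₃(G) ≥ 4/5.  The Petersen graph attains 4/5.
module Submission where

open import Defs
open import Data.Bool using (Bool; true; false; if_then_else_; _∧_; _∨_; T)
open import Data.Bool.Properties using (T?; ∧-zeroʳ; ∨-identityʳ)
  renaming (_≟_ to _≟ᵇ_)
open import Data.Fin
  using (Fin; zero; suc; #_; _≟_; punchIn; _↑ˡ_; _↑ʳ_; combine; remQuot; splitAt; join)
open import Data.Fin.Patterns
open import Data.Fin.Properties
  using (all?; any?; suc-injective; remQuot-combine; combine-surjective; combine-injective;
         combine-injectiveˡ; combine-injectiveʳ; splitAt-↑ˡ; splitAt-↑ʳ; ↑ˡ-injective; ↑ʳ-injective;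
         join-splitAt)
open import Data.Integer using (+_)
import Data.Integer as ℤ
import Data.Integer.Properties as ℤ
open import Data.Maybe using (Maybe; nothing; just; is-just; to-witness-T; _<∣>_)
import Data.Maybe as Maybe
open import Data.Nat as ℕ using (ℕ; zero; suc; _+_; _*_; _≤_; _≤?_; NonZero; z≤n; s≤s)
open import Data.Nat.Properties
  using (+-*-semiring; +-assoc; +-identityʳ; +-suc; +-mono-≤; +-monoˡ-≤; +-cancelˡ-≤; +-cancelʳ-≤;
         *-identityʳ; *-assoc; *-comm; *-cancelˡ-≡; *-cancelˡ-≤; *-monoˡ-≤; *-monoʳ-≤; m*n≢0;
         m≤n+m; m≤n⇒m≤1+n; ≤-trans; ≤-reflexive; ≰⇒≥; ≰⇒>; <⇒≱; module ≤-Reasoning)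
open import Data.Nat.Solver using (module +-*-Solver)
open import Data.Product using (_×_; _,_; proj₁; proj₂; ∃; map; map₂; uncurry)
open import Data.Rational using (_/_)
import Data.Rational as ℚ
import Data.Rational.Properties as ℚ
import Data.Rational.Unnormalised as ℚᵘ
import Data.Rational.Unnormalised.Properties as ℚᵘ
open import Data.Sum using (inj₁; inj₂)
open import Data.Vec using (Vec; []; _∷_; lookup; tabulate)
open import Data.Vec.Properties using (lookup∘tabulate; ≡-dec)
open import Function using (_∘_; _$_)
open import Relation.Binary.PropositionalEquality
open import Relation.Nullary using (¬_; contradiction)
open import Relation.Nullary.Decidable
  using (Dec; yes; no; ⌊_⌋; ¬?; map′; _×-dec_; _→-dec_; from-yes; True; toWitness;
         decidable-stable)
open import Algebra.Properties.Semiring.Sum +-*-semiring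
  using (sum; sum-cong-≗; ∑-distrib-+; ∑-comm; *-distribˡ-sum)

-- Counting and finite sums

bit : Bool → ℕ
bit b = if b then 1 else 0

count-cong : ∀ {n} {p q : Fin n → Bool} → p ≗ q → count p ≡ count q
count-cong {zero}  eq = refl
count-cong {suc n} eq = cong₂ (λ b c → bit b + c) (eq zero) (count-cong (eq ∘ suc))

anyFin-cong : ∀ {n} {p q : Fin n → Bool} → p ≗ q → anyFin p ≡ anyFin q
anyFin-cong {zero}  eq = refl
anyFin-cong {suc n} eq = cong₂ _∨_ (eq zero) (anyFin-cong (eq ∘ suc))

-- For a concrete s, countOn s p reduces to a sum over the support of s even when p is a variable;
-- count (λ k → p k ∧ s k) does not.
countOn : ∀ {n} → (Fin n → Bool) → (Fin n → Bool) → ℕ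
countOn {zero}  s p = 0
countOn {suc n} s p = (if s zero then (λ c → bit (p zero) + c) else (λ c → c)) (countOn (s ∘ suc) (p ∘ suc))

count-∧ : ∀ {n} (p s : Fin n → Bool) → count (λ k → p k ∧ s k) ≡ countOn s p
count-∧ {zero}  p s = refl
count-∧ {suc n} p s with count-∧ (p ∘ suc) (s ∘ suc) | p zero | s zero
... | eq | true  | true  = cong suc eq
... | eq | true  | false = eq
... | eq | false | true  = eq
... | eq | false | false = eq

count≡sum : ∀ {n} (p : Fin n → Bool) → count p ≡ sum (bit ∘ p)
count≡sum {zero}  p = refl
count≡sum {suc n} p = cong (λ c → bit (p zero) + c) (count≡sum (p ∘ suc))

count-none : ∀ {n} {p : Fin n → Bool} → (∀ i → p i ≡ false) → count p ≡ 0
count-none {zero}  none = refl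
count-none {suc n} none rewrite none zero = count-none (none ∘ suc)

count-all : ∀ n → count {n} (λ _ → true) ≡ n
count-all zero    = refl
count-all (suc n) = cong suc (count-all n)

count-+ : ∀ k {l} (p : Fin (k + l) → Bool) → count p ≡ count (p ∘ (_↑ˡ l)) + count (p ∘ (k ↑ʳ_))
count-+ zero    p = refl
count-+ (suc k) p = trans (cong (λ c → bit (p zero) + c) (count-+ k (p ∘ suc))) (sym (+-assoc (bit (p zero)) _ _))

count-* : ∀ k {l} (p : Fin (k * l) → Bool) → count p ≡ sum (λ (i : Fin k) → count (λ (j : Fin l) → p (combine i j)))
count-* zero        p = refl
count-* (suc k) {l} p = trans (count-+ l p) (cong (λ c → count (p ∘ (_↑ˡ (k * l))) + c) (count-* k (p ∘ (l ↑ʳ_))))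

sum-const : ∀ n c → sum {n} (λ _ → c) ≡ n * c
sum-const zero    c = refl
sum-const (suc n) c = cong (λ s → c + s) (sum-const n c)

sum-none : ∀ {n} {t : Fin n → ℕ} → (∀ i → t i ≡ 0) → sum t ≡ 0
sum-none {zero}  none = refl
sum-none {suc n} none = cong₂ _+_ (none zero) (sum-none (none ∘ suc))

sum-only : ∀ {n} {t : Fin n → ℕ} i → (∀ j → j ≢ i → t j ≡ 0) → sum t ≡ t i
sum-only {t = t} zero    others = trans (cong (λ c → t zero + c) (sum-none λ j → others (suc j) λ ())) (+-identityʳ _)
sum-only         (suc i) others = cong₂ _+_ (others zero λ ()) (sum-only i λ j j≢i → others (suc j) (j≢i ∘ suc-injective))

⌊⌋-⇔ : ∀ {P Q : Set} (P? : Dec P) (Q? : Dec Q) → (P → Q) → (Q → P) → ⌊ P? ⌋ ≡ ⌊ Q? ⌋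
⌊⌋-⇔ (yes p) (yes q) to from = refl
⌊⌋-⇔ (yes p) (no ¬q) to from = contradiction (to p) ¬q
⌊⌋-⇔ (no ¬p) (yes q) to from = contradiction (from q) ¬p
⌊⌋-⇔ (no ¬p) (no ¬q) to from = refl

⌊⌋-no : ∀ {P : Set} (P? : Dec P) → ¬ P → ⌊ P? ⌋ ≡ false
⌊⌋-no (yes p) ¬p = contradiction p ¬p
⌊⌋-no (no _)  ¬p = refl

⌊⌋-yes : ∀ {P : Set} (P? : Dec P) → P → ⌊ P? ⌋ ≡ true
⌊⌋-yes (yes _) p = refl
⌊⌋-yes (no ¬p) p = contradiction p ¬p

count≤n : ∀ {n} (p : Fin n → Bool) → count p ≤ n
count≤n {zero}  p = z≤n
count≤n {suc n} p with p zero
... | true  = s≤s (count≤n (p ∘ suc))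
... | false = m≤n⇒m≤1+n (count≤n (p ∘ suc))

sum-mono : ∀ {n} {s t : Fin n → ℕ} → (∀ i → s i ≤ t i) → sum s ≤ sum t
sum-mono {zero}  s≤t = z≤n
sum-mono {suc n} s≤t = +-mono-≤ (s≤t zero) (sum-mono (s≤t ∘ suc))

-- Pigeonhole: if the first term is below `c`, dropping it leaves the remaining terms with average
-- at least `c`.
average≤some : ∀ {n} (t : Fin (suc n) → ℕ) c → suc n * c ≤ sum t → ∃ λ i → c ≤ t i
average≤some {zero}  t c le = zero , subst₂ _≤_ (+-identityʳ c) (+-identityʳ (t zero)) le
average≤some {suc n} t c le with c ≤? t zero
... | yes c≤t₀ = zero , c≤t₀
... | no  c≰t₀ = let i , c≤tᵢ = average≤some (t ∘ suc) c rest in suc i , c≤tᵢ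
  where
  rest : suc n * c ≤ sum (t ∘ suc)
  rest = +-cancelˡ-≤ c _ _ (≤-trans le (+-monoˡ-≤ (sum (t ∘ suc)) (≰⇒≥ c≰t₀)))

-- Degree counting and the size of a perfect matching

-- The two ends of an edge differ, so at most one disjunct of `incident` holds and the disjunction
-- can be counted as a sum.
bit-incident : ∀ (G : Multigraph) b e v →
  bit (b ∧ incident G e v) ≡ bit (b ∧ ⌊ proj₁ (ends G e) ≟ v ⌋) + bit (b ∧ ⌊ proj₂ (ends G e) ≟ v ⌋)
bit-incident G false e v = refl
bit-incident G true  e v with proj₁ (ends G e) ≟ v | proj₂ (ends G e) ≟ v
... | yes x≡v | yes y≡v = contradiction (trans x≡v (sym y≡v)) (loopless G e)
... | yes _   | no _    = refl
... | no _    | yes _   = refl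
... | no _    | no _    = refl

sum-indicator : ∀ {n} (u : Fin n) → sum (λ v → bit ⌊ u ≟ v ⌋) ≡ 1
sum-indicator u = trans
  (sum-only u λ v v≢u → cong bit (⌊⌋-no (u ≟ v) (v≢u ∘ sym)))
  (cong bit (⌊⌋-yes (u ≟ u) refl))

handshake : ∀ (G : Multigraph) (M : EdgeSet G) →
  sum (λ v → count (λ e → M e ∧ incident G e v)) ≡ 2 * count M
handshake G M = begin
  sum (λ v → count (λ e → M e ∧ incident G e v))           ≡⟨ sum-cong-≗ (λ v → count≡sum (λ e → M e ∧ incident G e v)) ⟩
  sum (λ v → sum (λ e → bit (M e ∧ incident G e v)))       ≡⟨ ∑-comm {n G} {m G} (λ v e → bit (M e ∧ incident G e v)) ⟩
  sum (λ e → sum (λ v → bit (M e ∧ incident G e v)))       ≡⟨ sum-cong-≗ (λ e → twoEnds e (M e)) ⟩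
  sum (λ e → 2 * bit (M e))                                ≡⟨ *-distribˡ-sum 2 (bit ∘ M) ⟨
  2 * sum (bit ∘ M)                                        ≡⟨ cong (2 *_) (count≡sum M) ⟨
  2 * count M                                              ∎
  where
  open ≡-Reasoning
  twoEnds : ∀ e b → sum (λ v → bit (b ∧ incident G e v)) ≡ 2 * bit b
  twoEnds e false = sum-none {n G} (λ _ → refl)
  twoEnds e true  = begin
    sum (λ v → bit (incident G e v))
      ≡⟨ sum-cong-≗ (bit-incident G true e) ⟩
    sum (λ v → bit ⌊ proj₁ (ends G e) ≟ v ⌋ + bit ⌊ proj₂ (ends G e) ≟ v ⌋)
      ≡⟨ ∑-distrib-+ {n G} _ _ ⟩
    sum (λ v → bit ⌊ proj₁ (ends G e) ≟ v ⌋) + sum (λ v → bit ⌊ proj₂ (ends G e) ≟ v ⌋)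
      ≡⟨ cong₂ _+_ (sum-indicator (proj₁ (ends G e))) (sum-indicator (proj₂ (ends G e))) ⟩
    2 ∎

perfectMatching-size : ∀ (G : Multigraph) → Cubic G → ∀ M → PerfectMatching G M → 3 * count M ≡ m G
-- Handshaking for `M` (degree 1) gives n = 2|M|, and for all edges (degree 3) it gives 3n = 2m;
-- eliminating n leaves a common factor 2.
perfectMatching-size G cubic M pm = *-cancelˡ-≡ _ _ 2 (begin
  2 * (3 * count M)                        ≡⟨ *-assoc 2 3 (count M) ⟨
  3 * 2 * count M                          ≡⟨ *-assoc 3 2 (count M) ⟩
  3 * (2 * count M)                        ≡⟨ cong (3 *_) (regular M 1 pm) ⟨
  3 * (n G * 1)                            ≡⟨ cong (3 *_) (*-identityʳ (n G)) ⟩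
  3 * n G                                  ≡⟨ *-comm 3 (n G) ⟩
  n G * 3                                  ≡⟨ regular (λ _ → true) 3 cubic ⟩
  2 * count {m G} (λ _ → true)             ≡⟨ cong (2 *_) (count-all (m G)) ⟩
  2 * m G                                  ∎)
  where
  open ≡-Reasoning
  regular : ∀ (S : EdgeSet G) d → (∀ v → count (λ e → S e ∧ incident G e v) ≡ d) → n G * d ≡ 2 * count S
  regular S d deg = begin
    n G * d                                         ≡⟨ sum-const (n G) d ⟨
    sum {n G} (λ _ → d)                             ≡⟨ sum-cong-≗ deg ⟨
    sum (λ v → count (λ e → S e ∧ incident G e v))  ≡⟨ handshake G S ⟩
    2 * count S                                     ∎

-- Walks avoiding an edge

module _ {G : Multigraph} {f : Fin (m G)} where

  _++_ : ∀ {u v w} → WalkAvoiding G f u v → WalkAvoiding G f v w → WalkAvoiding G f u w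
  here            ++ q = q
  step e e≢f eq p ++ q = step e e≢f eq (p ++ q)

  private
    firstJust : ∀ {A : Set} {k} → (Fin k → Maybe A) → Maybe A
    firstJust {k = zero}  g = nothing
    firstJust {k = suc k} g = g zero <∣> firstJust (g ∘ suc)

  -- Depth-first search; the number bounds the length of the walk.
  searchWalk : ℕ → ∀ u v → Maybe (WalkAvoiding G f u v)
  searchWalk fuel u v with u ≟ v
  searchWalk fuel       u .u | yes refl = just here
  searchWalk zero       u v  | no _     = nothing
  searchWalk (suc fuel) u v  | no _     = firstJust via
    where
    via : Fin (m G) → Maybe (WalkAvoiding G f u v)
    via e with e ≟ f | proj₁ (ends G e) ≟ u | proj₂ (ends G e) ≟ u
    ... | yes _  | _        | _        = nothing
    ... | no e≢f | yes refl | _        = Maybe.map (step e e≢f (inj₁ refl)) (searchWalk fuel _ v)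
    ... | no e≢f | no _     | yes refl = Maybe.map (step e e≢f (inj₂ refl)) (searchWalk fuel _ v)
    ... | no _   | no _     | no _     = nothing

mapWalk : ∀ {G H : Multigraph} {f : Fin (m G)} {g : Fin (m H)} (φ : Fin (n G) → Fin (n H)) (ψ : Fin (m G) → Fin (m H)) →
  (∀ e → ends H (ψ e) ≡ map φ φ (ends G e)) → (∀ e → e ≢ f → ψ e ≢ g) →
  ∀ {u v} → WalkAvoiding G f u v → WalkAvoiding H g (φ u) (φ v)
mapWalk φ ψ hom avoids here = here
mapWalk φ ψ hom avoids (step e e≢f (inj₁ eq) p) =
  step (ψ e) (avoids e e≢f) (inj₁ (trans (hom e) (cong (map φ φ) eq))) (mapWalk φ ψ hom avoids p)
mapWalk φ ψ hom avoids (step e e≢f (inj₂ eq) p) =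
  step (ψ e) (avoids e e≢f) (inj₂ (trans (hom e) (cong (map φ φ) eq))) (mapWalk φ ψ hom avoids p)

-- The Petersen graph and the gadget cut from it

-- Edge 0 is the edge pq that is cut open in the gadget.
petersenEdges : Vec (Fin 10 × Fin 10) 15
petersenEdges =
  (# 0 , # 1) ∷ (# 1 , # 2) ∷ (# 2 , # 3) ∷ (# 3 , # 4) ∷ (# 4 , # 0) ∷
  (# 0 , # 5) ∷ (# 1 , # 6) ∷ (# 2 , # 7) ∷ (# 3 , # 8) ∷ (# 4 , # 9) ∷
  (# 5 , # 7) ∷ (# 6 , # 8) ∷ (# 7 , # 9) ∷ (# 8 , # 5) ∷ (# 9 , # 6) ∷ []

petersen : Multigraph
petersen = record
  { n        = 10
  ; m        = 15
  ; ends     = lookup petersenEdges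
  ; loopless = from-yes (all? λ e → ¬? (proj₁ (lookup petersenEdges e) ≟ proj₂ (lookup petersenEdges e)))
  }

-- Gadget edges 0 and 1 are the pendant halves xp and qy of Petersen edge 0, seen here only from the
-- gadget's own ten vertices (p = 0, q = 1); gadget edge 1 + k is Petersen edge k for k ≥ 1.
gadgetIncident : Fin 16 → Fin 10 → Bool
gadgetIncident zero          w = ⌊ # 0 ≟ w ⌋
gadgetIncident (suc zero)    w = ⌊ # 1 ≟ w ⌋
gadgetIncident (suc (suc j)) w = incident petersen (suc j) w

GadgetMatching : (Fin 16 → Bool) → Set
GadgetMatching M = ∀ w → count (λ k → M k ∧ gadgetIncident k w) ≡ 1

-- Glues the two pendant halves back into the cut edge, so a set of the form `N ∘ collapse` contains
-- both halves or neither.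
collapse : Fin 16 → Fin 15
collapse zero    = zero
collapse (suc k) = k

-- Perfect matchings of the Petersen graph and of the gadget

pattern ■ = true
pattern □ = false

-- Columns follow `petersenEdges`. Any two rows share exactly one edge and each edge lies in exactly
-- two rows, so edges correspond to pairs of rows. The cut edge is the pair of rows 0 and 1.
matchings : Vec (Vec Bool 15) 6
matchings =
  (■ ∷ □ ∷ ■ ∷ □ ∷ □ ∷ □ ∷ □ ∷ □ ∷ □ ∷ ■ ∷ ■ ∷ ■ ∷ □ ∷ □ ∷ □ ∷ []) ∷
  (■ ∷ □ ∷ □ ∷ ■ ∷ □ ∷ □ ∷ □ ∷ ■ ∷ □ ∷ □ ∷ □ ∷ □ ∷ □ ∷ ■ ∷ ■ ∷ []) ∷
  (□ ∷ ■ ∷ □ ∷ ■ ∷ □ ∷ ■ ∷ □ ∷ □ ∷ □ ∷ □ ∷ □ ∷ ■ ∷ ■ ∷ □ ∷ □ ∷ []) ∷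
  (□ ∷ ■ ∷ □ ∷ □ ∷ ■ ∷ □ ∷ □ ∷ □ ∷ ■ ∷ □ ∷ ■ ∷ □ ∷ □ ∷ □ ∷ ■ ∷ []) ∷
  (□ ∷ □ ∷ ■ ∷ □ ∷ ■ ∷ □ ∷ ■ ∷ □ ∷ □ ∷ □ ∷ □ ∷ □ ∷ ■ ∷ ■ ∷ □ ∷ []) ∷
  (□ ∷ □ ∷ □ ∷ □ ∷ □ ∷ ■ ∷ ■ ∷ ■ ∷ ■ ∷ ■ ∷ □ ∷ □ ∷ □ ∷ □ ∷ □ ∷ []) ∷ []

matching : Fin 6 → Fin 15 → Bool
matching r = lookup (lookup matchings r)

allVec? : ∀ n {P : Vec Bool n → Set} → (∀ v → Dec (P v)) → Dec (∀ v → P v)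
allVec? zero    P? = map′ (λ { p [] → p }) (_$ []) (P? [])
allVec? (suc n) P? = map′
  (λ { (t , f) (true ∷ v) → t v ; (t , f) (false ∷ v) → f v })
  (λ p → (p ∘ (true ∷_)) , (p ∘ (false ∷_)))
  (allVec? n (P? ∘ (true ∷_)) ×-dec allVec? n (P? ∘ (false ∷_)))

-- The three gadget edges at each vertex, tabulated so that the brute force does three lookups per
-- vertex instead of a count over 16 edges.
gadgetStar : Fin 10 → Vec (Fin 16) 3
gadgetStar w = lookup stars w where
  stars : Vec (Vec (Fin 16) 3) 10
  stars =
    (# 0 ∷ # 5 ∷ # 6 ∷ []) ∷ (# 1 ∷ # 2 ∷ # 7 ∷ []) ∷ (# 2 ∷ # 3 ∷ # 8 ∷ []) ∷
    (# 3 ∷ # 4 ∷ # 9 ∷ []) ∷ (# 4 ∷ # 5 ∷ # 10 ∷ []) ∷ (# 6 ∷ # 11 ∷ # 14 ∷ []) ∷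
    (# 7 ∷ # 12 ∷ # 15 ∷ []) ∷ (# 8 ∷ # 11 ∷ # 13 ∷ []) ∷ (# 9 ∷ # 12 ∷ # 14 ∷ []) ∷
    (# 10 ∷ # 13 ∷ # 15 ∷ []) ∷ []

starCount : Vec (Fin 16) 3 → Vec Bool 16 → ℕ
starCount (a ∷ b ∷ c ∷ []) v = bit (lookup v a) + (bit (lookup v b) + (bit (lookup v c) + 0))

-- Brute force over all 2¹⁶ edge sets of the gadget; abstract, since later goals must not unfold it.
abstract
  classify : ∀ v → (∀ w → starCount (gadgetStar w) v ≡ 1) → ∃ λ r → v ≡ tabulate (matching r ∘ collapse)
  classify = from-yes (allVec? 16 λ v →
    all? (λ w → starCount (gadgetStar w) v ℕ.≟ 1) →-dec any? λ r → ≡-dec _≟ᵇ_ v (tabulate (matching r ∘ collapse)))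

-- For a concrete `w` both sides compute to the same sum of three bits, because the stars list their
-- edges in increasing order.
countOn-star : ∀ M w → countOn (λ k → gadgetIncident k w) M ≡ starCount (gadgetStar w) (tabulate M)
countOn-star M 0F = refl
countOn-star M 1F = refl
countOn-star M 2F = refl
countOn-star M 3F = refl
countOn-star M 4F = refl
countOn-star M 5F = refl
countOn-star M 6F = refl
countOn-star M 7F = refl
countOn-star M 8F = refl
countOn-star M 9F = refl

countOn-collapse : ∀ N w →
  countOn (λ k → gadgetIncident k w) (N ∘ collapse) ≡ countOn (λ e → incident petersen e w) N
countOn-collapse N 0F = refl
countOn-collapse N 1F = refl
countOn-collapse N 2F = refl
countOn-collapse N 3F = refl
countOn-collapse N 4F = refl
countOn-collapse N 5F = refl
countOn-collapse N 6F = refl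
countOn-collapse N 7F = refl
countOn-collapse N 8F = refl
countOn-collapse N 9F = refl

-- This contains the parity argument: as `M` factors through `collapse`, it takes both pendant edges
-- or none.
gadgetMatching-classification : ∀ M → GadgetMatching M → ∃ λ r → M ≗ matching r ∘ collapse
gadgetMatching-classification M pm = map₂ pointwise (classify (tabulate M) λ w →
    trans (sym (countOn-star M w)) (trans (sym (count-∧ M (λ k → gadgetIncident k w))) (pm w)))
  where
  pointwise : ∀ {g} → tabulate M ≡ tabulate g → M ≗ g
  pointwise {g} eq k = trans (sym (lookup∘tabulate M k)) (trans (cong (λ v → lookup v k) eq) (lookup∘tabulate g k))

-- Pulling `N` back along `collapse` gives a gadget matching, so the one brute-force check serves
-- both graphs.
petersenMatching-classification : ∀ N → PerfectMatching petersen N → ∃ λ r → N ≗ matching r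
petersenMatching-classification N pm = map₂ (λ eq e → eq (suc e)) (gadgetMatching-classification (N ∘ collapse) collapsed)
  where
  open ≡-Reasoning
  collapsed : GadgetMatching (N ∘ collapse)
  collapsed w = begin
    count (λ k → N (collapse k) ∧ gadgetIncident k w)       ≡⟨ count-∧ (N ∘ collapse) (λ k → gadgetIncident k w) ⟩
    countOn (λ k → gadgetIncident k w) (N ∘ collapse)        ≡⟨ countOn-collapse N w ⟩
    countOn (λ e → incident petersen e w) N                 ≡⟨ count-∧ N (λ e → incident petersen e w) ⟨
    count (λ e → N e ∧ incident petersen e w)               ≡⟨ pm w ⟩
    1                                                       ∎

matching-perfect : ∀ r → PerfectMatching petersen (matching r)
matching-perfect = from-yes (all? λ r → all? λ w → count (λ e → matching r e ∧ incident petersen e w) ℕ.≟ 1)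

gadgetMatching-matching : ∀ r → GadgetMatching (matching r ∘ collapse)
gadgetMatching-matching = from-yes (all? λ r → all? λ w →
  count (λ k → matching r (collapse k) ∧ gadgetIncident k w) ℕ.≟ 1)

gadget-cubic : ∀ w → count (λ k → gadgetIncident k w) ≡ 3
gadget-cubic = from-yes (all? λ w → count (λ k → gadgetIncident k w) ℕ.≟ 3)

petersen-cubic : Cubic petersen
petersen-cubic = from-yes (all? λ w → degree petersen w ℕ.≟ 3)

-- Three distinct rows cover 15 - 3 edges, since each pair shares one edge and no edge lies in three
-- rows; repeated rows cover fewer.
threeMatchings≤12 : ∀ (r : Fin 3 → Fin 6) → count (λ e → anyFin (λ i → matching (r i) e)) ≤ 12
threeMatchings≤12 r = checked (r 0F) (r 1F) (r 2F)
  where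
  -- Functions out of `Fin 3` cannot be enumerated directly; `anyFin` only evaluates `r` at three
  -- points, so a vector of its values gives the same statement by computation.
  checked : ∀ a b c → count (λ e → anyFin (λ i → matching (lookup (a ∷ b ∷ c ∷ []) i) e)) ≤ 12
  checked = from-yes (all? λ a → all? λ b → all? λ c →
    count (λ e → anyFin (λ i → matching (lookup (a ∷ b ∷ c ∷ []) i) e)) ≤? 12)

-- (triples missing the cut edge) ≤ 2u − i, with both sides moved so
-- that no subtraction occurs.
FourMatchingsBound : (Fin 4 → Fin 6) → Set
FourMatchingsBound r =
  2 * count (λ k → anyFin (λ i → matching (r i) (collapse k))) + sum (λ i → bit (matching (r i) zero))
    ≤ 28 + sum (λ j → bit (anyFin (λ i → matching (r (punchIn j i)) zero)))

fourMatchingsBound? : ∀ r → Dec (FourMatchingsBound r)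
fourMatchingsBound? r = _ ≤? _

-- The constant is 28 = 2 · 16 - 4. Four distinct rows leave uncovered only the Petersen edge shared
-- by the other two rows, and then equality holds. With a repetition u ≥ 3, while i and the number
-- of missing triples add up to at most 4.
fourMatchings-bound : ∀ r → FourMatchingsBound r
fourMatchings-bound r = checked (r 0F) (r 1F) (r 2F) (r 3F)
  where
  checked : ∀ a b c d → FourMatchingsBound (lookup (a ∷ b ∷ c ∷ d ∷ []))
  checked = from-yes (all? λ a → all? λ b → all? λ c → all? λ d → fourMatchingsBound? (lookup (a ∷ b ∷ c ∷ d ∷ [])))

-- Bridgelessness of the Petersen graph, also after deleting an edge

searchBridgeless : ∀ G fuel →
  True (all? λ e → T? (is-just (searchWalk {G} {e} fuel (proj₁ (ends G e)) (proj₂ (ends G e))))) →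
  Bridgeless G
searchBridgeless G fuel found e = to-witness-T _ (toWitness found e)

petersen-bridgeless : Bridgeless petersen
-- Each edge lies on a 5-cycle, whose other four edges form the detour.
petersen-bridgeless = searchBridgeless petersen 4 _

petersenMinusEdge : Multigraph
petersenMinusEdge = record
  { n = 10 ; m = 14 ; ends = ends petersen ∘ suc ; loopless = loopless petersen ∘ suc }

petersenMinusEdge-bridgeless : Bridgeless petersenMinusEdge
petersenMinusEdge-bridgeless = searchBridgeless petersenMinusEdge 4 _

-- The avoided edge `# 0` is an arbitrary choice: this walk and `back` are used where the edge
-- avoided in the large graph is not an internal edge of the copy being crossed.
across : WalkAvoiding petersenMinusEdge (# 0) (# 0) (# 1)
across = to-witness-T (searchWalk 4 (# 0) (# 1)) _

back : WalkAvoiding petersenMinusEdge (# 0) (# 1) (# 0)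
back = to-witness-T (searchWalk 4 (# 1) (# 0)) _

-- Replacing every edge by a gadget

module Substitution (G : Multigraph) where

  Vertex : Set
  Vertex = Fin (n G + m G * 10)

  outer : Fin (n G) → Vertex
  outer v = v ↑ˡ (m G * 10)

  inner : Fin (m G) → Fin 10 → Vertex
  inner e w = n G ↑ʳ combine e w

  link : Fin (m G) → Fin 16 → Fin (m G * 16)
  link = combine

  outer≢inner : ∀ v e w → outer v ≢ inner e w
  outer≢inner v e w eq
    with trans (sym (splitAt-↑ˡ (n G) v (m G * 10))) (trans (cong (splitAt (n G)) eq) (splitAt-↑ʳ (n G) (m G * 10) (combine e w)))
  ... | ()

  outer-injective : ∀ {u v} → outer u ≡ outer v → u ≡ v
  outer-injective = ↑ˡ-injective (m G * 10) _ _

  inner-injective : ∀ {e w e′ w′} → inner e w ≡ inner e′ w′ → e ≡ e′ × w ≡ w′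
  inner-injective {e} {w} {e′} {w′} = combine-injective e w e′ w′ ∘ ↑ʳ-injective (n G) _ _

  vertexInduction : (P : Vertex → Set) → (∀ v → P (outer v)) → (∀ e w → P (inner e w)) → ∀ u → P u
  vertexInduction P onOuter onInner u = subst P (join-splitAt (n G) (m G * 10) u) (go (splitAt (n G) u))
    where
    go : ∀ s → P (join (n G) (m G * 10) s)
    go (inj₁ v) = onOuter v
    go (inj₂ i) with combine-surjective {m G} {10} i
    ... | e , w , refl = onInner e w

  edgeInduction : (P : Fin (m G * 16) → Set) → (∀ e k → P (link e k)) → ∀ f → P f
  edgeInduction P onLink f with combine-surjective {m G} {16} f
  ... | e , k , refl = onLink e k

  gadgetEnds : Fin (m G) → Fin 16 → Vertex × Vertex
  gadgetEnds e 0F            = outer (proj₁ (ends G e)) , inner e 0F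
  gadgetEnds e 1F            = inner e 1F , outer (proj₂ (ends G e))
  gadgetEnds e (suc (suc j)) = map (inner e) (inner e) (ends petersen (suc j))

  ends′ : Fin (m G * 16) → Vertex × Vertex
  ends′ f = uncurry gadgetEnds (remQuot 16 f)

  ends-link : ∀ e k → ends′ (link e k) ≡ gadgetEnds e k
  ends-link e k = cong (uncurry gadgetEnds) (remQuot-combine e k)

  gadgetEnds-distinct : ∀ e k → proj₁ (gadgetEnds e k) ≢ proj₂ (gadgetEnds e k)
  gadgetEnds-distinct e 0F            = outer≢inner _ e 0F
  gadgetEnds-distinct e 1F            = outer≢inner _ e 1F ∘ sym
  gadgetEnds-distinct e (suc (suc j)) = loopless petersen (suc j) ∘ proj₂ ∘ inner-injective

  substitution : Multigraph
  substitution = record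
    { n        = n G + m G * 10
    ; m        = m G * 16
    ; ends     = ends′
    ; loopless = λ f → gadgetEnds-distinct (proj₁ (remQuot {m G} 16 f)) (proj₂ (remQuot {m G} 16 f))
    }

  isEnd : Vertex × Vertex → Vertex → Bool
  isEnd (x , y) u = ⌊ x ≟ u ⌋ ∨ ⌊ y ≟ u ⌋

  incident-link : ∀ e k u → incident substitution (link e k) u ≡ isEnd (gadgetEnds e k) u
  incident-link e k u = cong (λ xy → isEnd xy u) (ends-link e k)

  outer-≟ : ∀ u v → ⌊ outer u ≟ outer v ⌋ ≡ ⌊ u ≟ v ⌋
  outer-≟ u v = ⌊⌋-⇔ (outer u ≟ outer v) (u ≟ v) outer-injective (cong outer)

  inner-≟ : ∀ e w w′ → ⌊ inner e w ≟ inner e w′ ⌋ ≡ ⌊ w ≟ w′ ⌋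
  inner-≟ e w w′ = ⌊⌋-⇔ (inner e w ≟ inner e w′) (w ≟ w′) (proj₂ ∘ inner-injective) (cong (inner e))

  outer-inner-≟ : ∀ v e w → ⌊ outer v ≟ inner e w ⌋ ≡ false
  outer-inner-≟ v e w = ⌊⌋-no (outer v ≟ inner e w) (outer≢inner v e w)

  inner-outer-≟ : ∀ e w v → ⌊ inner e w ≟ outer v ⌋ ≡ false
  inner-outer-≟ e w v = ⌊⌋-no (inner e w ≟ outer v) (outer≢inner v e w ∘ sym)

  inner-inner-≟ : ∀ {e e′} → e′ ≢ e → ∀ w′ w → ⌊ inner e′ w′ ≟ inner e w ⌋ ≡ false
  inner-inner-≟ {e} {e′} e′≢e w′ w = ⌊⌋-no (inner e′ w′ ≟ inner e w) (e′≢e ∘ proj₁ ∘ inner-injective)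

  isEnd-same : ∀ e k w → isEnd (gadgetEnds e k) (inner e w) ≡ gadgetIncident k w
  isEnd-same e 0F            w = cong₂ _∨_ (outer-inner-≟ _ e w) (inner-≟ e 0F w)
  isEnd-same e 1F            w =
    trans (cong₂ _∨_ (inner-≟ e 1F w) (outer-inner-≟ _ e w)) (∨-identityʳ _)
  isEnd-same e (suc (suc j)) w = cong₂ _∨_ (inner-≟ e _ w) (inner-≟ e _ w)

  isEnd-other : ∀ {e e′} → e′ ≢ e → ∀ k w → isEnd (gadgetEnds e′ k) (inner e w) ≡ false
  isEnd-other e′≢e 0F            w = cong₂ _∨_ (outer-inner-≟ _ _ w) (inner-inner-≟ e′≢e 0F w)
  isEnd-other e′≢e 1F            w = cong₂ _∨_ (inner-inner-≟ e′≢e 1F w) (outer-inner-≟ _ _ w)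
  isEnd-other e′≢e (suc (suc j)) w = cong₂ _∨_ (inner-inner-≟ e′≢e _ w) (inner-inner-≟ e′≢e _ w)

  -- Only gadget `e` meets its own vertices, so the sum over gadgets has one nonzero term. A general
  -- `S` covers degrees and matchings alike.
  count-inner : ∀ (S : EdgeSet substitution) e w →
    count (λ f → S f ∧ incident substitution f (inner e w)) ≡ count (λ k → S (link e k) ∧ gadgetIncident k w)
  count-inner S e w = begin
    count (λ f → S f ∧ incident substitution f (inner e w))
      ≡⟨ count-* (m G) _ ⟩
    sum (λ e′ → count (λ k → S (link e′ k) ∧ incident substitution (link e′ k) (inner e w)))
      ≡⟨ sum-only e (λ e′ e′≢e → count-none λ k →
           trans (cong (S (link e′ k) ∧_) (trans (incident-link e′ k _) (isEnd-other e′≢e k w))) (∧-zeroʳ _)) ⟩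
    count (λ k → S (link e k) ∧ incident substitution (link e k) (inner e w))
      ≡⟨ count-cong (λ k → cong (S (link e k) ∧_) (trans (incident-link e k _) (isEnd-same e k w))) ⟩
    count (λ k → S (link e k) ∧ gadgetIncident k w) ∎
    where open ≡-Reasoning

  -- An old vertex meets only pendant edges. The two pendants of `e` contribute one summand for each
  -- end of `e`, which `bit-incident` recombines.
  count-outer : ∀ (S : EdgeSet substitution) (M : EdgeSet G) →
    (∀ e → S (link e 0F) ≡ M e) → (∀ e → S (link e 1F) ≡ M e) → ∀ v →
    count (λ f → S f ∧ incident substitution f (outer v)) ≡ count (λ e → M e ∧ incident G e v)
  count-outer S M S₀ S₁ v = begin
    count (λ f → S f ∧ incident substitution f (outer v))
      ≡⟨ count-* (m G) _ ⟩
    sum (λ e → count (λ k → S (link e k) ∧ incident substitution (link e k) (outer v)))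
      ≡⟨ sum-cong-≗ gadget ⟩
    sum (λ e → bit (M e ∧ incident G e v))
      ≡⟨ count≡sum (λ e → M e ∧ incident G e v) ⟨
    count (λ e → M e ∧ incident G e v) ∎
    where
    open ≡-Reasoning
    at : ∀ e k {b c} → S (link e k) ≡ b → isEnd (gadgetEnds e k) (outer v) ≡ c →
      S (link e k) ∧ incident substitution (link e k) (outer v) ≡ b ∧ c
    at e k S≡b end≡c = cong₂ _∧_ S≡b (trans (incident-link e k _) end≡c)
    gadget : ∀ e → count (λ k → S (link e k) ∧ incident substitution (link e k) (outer v)) ≡ bit (M e ∧ incident G e v)
    gadget e = trans
      (cong₂ _+_
        (cong bit (at e 0F (S₀ e) (trans (cong₂ _∨_ (outer-≟ _ v) (inner-outer-≟ e 0F v)) (∨-identityʳ _))))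
        (trans (cong₂ _+_
          (cong bit (at e 1F (S₁ e) (cong₂ _∨_ (inner-outer-≟ e 1F v) (outer-≟ _ v))))
          (count-none λ j → trans (at e (suc (suc j)) refl (cong₂ _∨_ (inner-outer-≟ e _ v) (inner-outer-≟ e _ v))) (∧-zeroʳ _)))
          (+-identityʳ _)))
      (sym (bit-incident G (M e) e v))

  substitution-cubic : Cubic G → Cubic substitution
  substitution-cubic cubic = vertexInduction (λ u → degree substitution u ≡ 3)
    (λ v → trans (count-outer (λ _ → true) (λ _ → true) (λ _ → refl) (λ _ → refl) v) (cubic v))
    (λ e w → trans (count-inner (λ _ → true) e w) (gadget-cubic w))

  inGadget : ∀ {f} e j → (∀ i → i ≢ j → link e (suc (suc i)) ≢ f) → ∀ {u v} →
    WalkAvoiding petersenMinusEdge j u v → WalkAvoiding substitution f (inner e u) (inner e v)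
  inGadget e j avoids = mapWalk (inner e) (λ i → link e (suc (suc i))) (λ i → ends-link e (suc (suc i))) avoids

  link-≢ˡ : ∀ {e e′} → e′ ≢ e → ∀ {k k′} → link e′ k′ ≢ link e k
  link-≢ˡ e′≢e = e′≢e ∘ combine-injectiveˡ _ _ _ _

  link-≢ʳ : ∀ e {k k′} → k′ ≢ k → link e k′ ≢ link e k
  link-≢ʳ e k′≢k = k′≢k ∘ combine-injectiveʳ e _ e _

  -- Each step along `e′` becomes pendant edge, crossing of the gadget, pendant edge. Since
  -- `e′ ≢ e`, it stays clear of the whole gadget of `e`.
  lift : ∀ {e k u v} → WalkAvoiding G e u v → WalkAvoiding substitution (link e k) (outer u) (outer v)
  lift here = here
  lift (step e′ e′≢e (inj₁ refl) p) =
    step (link e′ 0F) (link-≢ˡ e′≢e) (inj₁ (ends-link e′ 0F)) (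
    inGadget e′ _ (λ _ _ → link-≢ˡ e′≢e) across ++
    step (link e′ 1F) (link-≢ˡ e′≢e) (inj₁ (ends-link e′ 1F)) (lift p))
  lift (step e′ e′≢e (inj₂ refl) p) =
    step (link e′ 1F) (link-≢ˡ e′≢e) (inj₂ (ends-link e′ 1F)) (
    inGadget e′ _ (λ _ _ → link-≢ˡ e′≢e) back ++
    step (link e′ 0F) (link-≢ˡ e′≢e) (inj₂ (ends-link e′ 0F)) (lift p))

  substitution-bridgeless : Bridgeless G → Bridgeless substitution
  substitution-bridgeless bridgeless = edgeInduction
    (λ f → WalkAvoiding substitution f (proj₁ (ends′ f)) (proj₂ (ends′ f)))
    (λ e k → subst (λ xy → WalkAvoiding substitution (link e k) (proj₁ xy) (proj₂ xy)) (sym (ends-link e k)) (detour e k))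
    where
    detour : ∀ e k → WalkAvoiding substitution (link e k) (proj₁ (gadgetEnds e k)) (proj₂ (gadgetEnds e k))
    -- From x to y by a lifted walk avoiding e, in through the other pendant edge to q, then across
    -- to p. The case of qy runs the other way round; an internal edge has its detour inside the
    -- copy.
    detour e 0F = lift (bridgeless e) ++
      step (link e 1F) (link-≢ʳ e λ ()) (inj₂ (ends-link e 1F))
      (inGadget e _ (λ _ _ → link-≢ʳ e λ ()) back)
    detour e 1F = inGadget e _ (λ _ _ → link-≢ʳ e λ ()) back ++
      step (link e 0F) (link-≢ʳ e λ ()) (inj₂ (ends-link e 0F))
      (lift (bridgeless e))
    detour e (suc (suc j)) =
      inGadget e j (λ i i≢j → link-≢ʳ e (i≢j ∘ suc-injective ∘ suc-injective)) (petersenMinusEdge-bridgeless j)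

  gadgetMatching-restrict : ∀ {S} → PerfectMatching substitution S → ∀ e → ∃ λ r → ∀ k → S (link e k) ≡ matching r (collapse k)
  gadgetMatching-restrict {S} pm e =
    gadgetMatching-classification (S ∘ link e) λ w → trans (sym (count-inner S e w)) (pm (inner e w))

  restrict : EdgeSet substitution → EdgeSet G
  restrict S e = S (link e 0F)

  -- `restrict` reads only the pendant edge xp; by the classification qy agrees with it, as
  -- `count-outer` requires.
  restrict-perfect : ∀ {S} → PerfectMatching substitution S → PerfectMatching G (restrict S)
  restrict-perfect {S} pm v = trans (sym (count-outer S (restrict S) (λ _ → refl) pendants v)) (pm (outer v))
    where
    pendants : ∀ e → S (link e 1F) ≡ S (link e 0F)
    pendants e = trans (row 1F) (sym (row 0F))
      where row = proj₂ (gadgetMatching-restrict {S} pm e)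

  -- Any row with the prescribed value at the cut edge would do; row 0 contains that edge and row 5
  -- does not.
  rowContaining : Bool → Fin 6
  rowContaining true  = # 0
  rowContaining false = # 5

  extend : EdgeSet G → EdgeSet substitution
  extend M f = matching (rowContaining (M (proj₁ (remQuot {m G} 16 f)))) (collapse (proj₂ (remQuot {m G} 16 f)))

  extend-link : ∀ M e k → extend M (link e k) ≡ matching (rowContaining (M e)) (collapse k)
  extend-link M e k = cong (λ (e , k) → matching (rowContaining (M e)) (collapse k)) (remQuot-combine e k)

  matching-rowContaining : ∀ b → matching (rowContaining b) 0F ≡ b
  matching-rowContaining true  = refl
  matching-rowContaining false = refl

  extend-perfect : ∀ {M} → PerfectMatching G M → PerfectMatching substitution (extend M)
  extend-perfect {M} pm = vertexInduction _
    (λ v → trans (count-outer (extend M) M (pendant 0F refl) (pendant 1F refl) v) (pm v))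
    (λ e w → trans (count-inner (extend M) e w)
       (trans (count-cong λ k → cong (_∧ gadgetIncident k w) (extend-link M e k)) (gadgetMatching-matching (rowContaining (M e)) w)))
    where
    pendant : ∀ k → collapse k ≡ 0F → ∀ e → extend M (link e k) ≡ M e
    pendant k k₀ e = trans (extend-link M e k) (trans (cong (matching (rowContaining (M e))) k₀) (matching-rowContaining (M e)))

-- Comparing fractions by cross-multiplication

-- `_/_` reduces to lowest terms, so the comparison passes through unnormalised fractions, where it
-- is cross-multiplication.
/-mono-≤ : ∀ a b c d .{{_ : NonZero b}} .{{_ : NonZero d}} → a * d ≤ c * b → (+ a / b) ℚ.≤ (+ c / d)
/-mono-≤ a (suc b) c (suc d) le = ℚ.toℚᵘ-cancel-≤ (begin
  ℚ.toℚᵘ (+ a / suc b)   ≃⟨ ℚ.toℚᵘ-fromℚᵘ (ℚᵘ.mkℚᵘ (+ a) b) ⟩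
  ℚᵘ.mkℚᵘ (+ a) b        ≤⟨ ℚᵘ.*≤* (subst₂ ℤ._≤_ (ℤ.pos-* a (suc d)) (ℤ.pos-* c (suc b)) (ℤ.+≤+ le)) ⟩
  ℚᵘ.mkℚᵘ (+ c) d        ≃⟨ ℚ.toℚᵘ-fromℚᵘ (ℚᵘ.mkℚᵘ (+ c) d) ⟨
  ℚ.toℚᵘ (+ c / suc d)   ∎)
  where open ℚᵘ.≤-Reasoning

/-cancel-≤ : ∀ a b c d .{{_ : NonZero b}} .{{_ : NonZero d}} → (+ a / b) ℚ.≤ (+ c / d) → a * d ≤ c * b
/-cancel-≤ a (suc b) c (suc d) le = ℤ.drop‿+≤+
  (subst₂ ℤ._≤_ (sym (ℤ.pos-* a (suc d))) (sym (ℤ.pos-* c (suc b))) (ℚᵘ.drop-*≤* (begin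
    ℚᵘ.mkℚᵘ (+ a) b        ≃⟨ ℚ.toℚᵘ-fromℚᵘ (ℚᵘ.mkℚᵘ (+ a) b) ⟨
    ℚ.toℚᵘ (+ a / suc b)   ≤⟨ ℚ.toℚᵘ-mono-≤ le ⟩
    ℚ.toℚᵘ (+ c / suc d)   ≃⟨ ℚ.toℚᵘ-fromℚᵘ (ℚᵘ.mkℚᵘ (+ c) d) ⟩
    ℚᵘ.mkℚᵘ (+ c) d        ∎)))
  where open ℚᵘ.≤-Reasoning

-- Existence of a maximum

covered : ∀ {k t} → (Fin t → Fin k → Bool) → ℕ
covered Ms = count (λ e → anyFin (λ i → Ms i e))

-- Enough because the goal 4/5 ≤ x is decidable; it avoids enumerating all tuples of edge sets.
maximum-exists : ∀ t H (Ms : Fin t → EdgeSet (graph H)) → (∀ i → PerfectMatching (graph H) (Ms i)) →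
  ¬ ¬ ∃ (IsMt t H)
maximum-exists t H Ms₀ pm₀ noMax = climb (m (graph H)) Ms₀ pm₀ (m≤n+m _ _)
  where
  instance _ = nonempty H
  -- `gap` bounds the number of uncovered edges; a strictly better tuple lowers it, so the climb
  -- ends.
  climb : ∀ gap (Ms : Fin t → EdgeSet (graph H)) → (∀ i → PerfectMatching (graph H) (Ms i)) →
    ¬ (m (graph H) ≤ covered Ms + gap)
  climb gap Ms pm small = noMax (unionRatio H t Ms , (Ms , pm , refl) , bound)
    where
    better : ∀ gap → m (graph H) ≤ covered Ms + gap →
      ∀ (Ms′ : Fin t → EdgeSet (graph H)) → (∀ i → PerfectMatching (graph H) (Ms′ i)) → ¬ (covered Ms ℕ.< covered Ms′)
    better zero      small Ms′ pm′ lt = <⇒≱ lt (≤-trans (count≤n _) (subst (m (graph H) ≤_) (+-identityʳ _) small))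
    better (suc gap) small Ms′ pm′ lt =
      climb gap Ms′ pm′ (≤-trans small (≤-trans (≤-reflexive (+-suc (covered Ms) gap)) (+-monoˡ-≤ gap lt)))
    bound : ∀ Ms′ → (∀ i → PerfectMatching (graph H) (Ms′ i)) → unionRatio H t Ms′ ℚ.≤ unionRatio H t Ms
    bound Ms′ pm′ with covered Ms′ ≤? covered Ms
    ... | yes le = /-mono-≤ (covered Ms′) (m (graph H)) (covered Ms) (m (graph H)) (*-monoˡ-≤ (m (graph H)) le)
    ... | no ¬le = contradiction (≰⇒> ¬le) (better gap small Ms′ pm′)

-- Averaging over the four triples

module _ (G : Multigraph) (cubic : Cubic G) where
  open Substitution G

  some-triple : (S : Fin 4 → EdgeSet substitution) → (∀ i → PerfectMatching substitution (S i)) →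
    14 * (m G * 16) ≤ covered S * 15 →
    ∃ λ j → 4 * m G ≤ 5 * covered (λ i → restrict (S (punchIn j i)))
  -- The four values 5 · `C j` sum to at least 16m, so one of them is at least 4m.
  some-triple S pm large = average≤some _ (4 * m G) (subst (4 * (4 * m G) ≤_) (*-distribˡ-sum 5 C) (*-cancelˡ-≤ 3 (+-cancelʳ-≤ (420 * m G) _ _ bound)))
    where
    open +-*-Solver
    C : Fin 4 → ℕ
    C j = covered (λ i → restrict (S (punchIn j i)))

    row : ∀ i e → ∃ λ r → ∀ k → S i (link e k) ≡ matching r (collapse k)
    row i = gadgetMatching-restrict {S i} (pm i)

    onGadget : ∀ e → 2 * count (λ k → anyFin (λ i → S i (link e k))) + sum (λ i → bit (restrict (S i) e))
                       ≤ 28 + sum (λ j → bit (anyFin (λ i → restrict (S (punchIn j i)) e)))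
    onGadget e = subst₂ _≤_
      (cong₂ _+_
        (cong (2 *_) (count-cong λ k → anyFin-cong λ i → sym (proj₂ (row i e) k)))
        (sum-cong-≗ λ i → cong bit (sym (proj₂ (row i e) 0F))))
      (cong (λ t → 28 + t) (sum-cong-≗ λ j → cong bit (anyFin-cong λ i → sym (proj₂ (row (punchIn j i) e) 0F))))
      (fourMatchings-bound λ i → proj₁ (row i e))

    total : 2 * covered S + sum (λ i → count (restrict (S i))) ≤ m G * 28 + sum C
    total = begin
      2 * covered S + sum (λ i → count (restrict (S i)))
        ≡⟨ cong₂ _+_
             (trans (cong (2 *_) (count-* (m G) {16} _)) (*-distribˡ-sum 2 (λ e → count (λ k → anyFin (λ i → S i (link e k))))))
             (trans (sum-cong-≗ λ i → count≡sum (restrict (S i))) (∑-comm {4} {m G} (λ i e → bit (restrict (S i) e)))) ⟩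
      sum (λ e → 2 * count (λ k → anyFin (λ i → S i (link e k)))) + sum (λ e → sum (λ i → bit (restrict (S i) e)))
        ≡⟨ ∑-distrib-+ {m G} _ _ ⟨
      sum (λ e → 2 * count (λ k → anyFin (λ i → S i (link e k))) + sum (λ i → bit (restrict (S i) e)))
        ≤⟨ sum-mono onGadget ⟩
      sum (λ e → 28 + sum (λ j → bit (anyFin (λ i → restrict (S (punchIn j i)) e))))
        ≡⟨ ∑-distrib-+ {m G} (λ _ → 28) _ ⟩
      sum {m G} (λ _ → 28) + sum (λ e → sum (λ j → bit (anyFin (λ i → restrict (S (punchIn j i)) e))))
        ≡⟨ cong₂ _+_ (sum-const (m G) 28)
             (trans (∑-comm {m G} {4} (λ e j → bit (anyFin (λ i → restrict (S (punchIn j i)) e))))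
                    (sum-cong-≗ λ j → sym (count≡sum (λ e → anyFin (λ i → restrict (S (punchIn j i)) e))))) ⟩
      m G * 28 + sum C ∎
      where open ≤-Reasoning

    sizes : 3 * sum (λ i → count (restrict (S i))) ≡ 4 * m G
    sizes = trans (*-distribˡ-sum 3 (λ i → count (restrict (S i))))
      (trans (sum-cong-≗ λ i → perfectMatching-size G cubic _ (restrict-perfect {S i} (pm i))) (sum-const 4 (m G)))

    bound : 3 * (4 * (4 * m G)) + 420 * m G ≤ 3 * (5 * sum C) + 420 * m G
    -- Fifteen times `total` reads 448m + 20m ≤ 420m + 15 · `sum C`, with 448m from `large` and 20m
    -- from `sizes`. The term 420m = 15 · 28m is kept on both sides to avoid subtraction.
    bound = begin
      3 * (4 * (4 * m G)) + 420 * m G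
        ≡⟨ solve 1 (λ x → con 3 :* (con 4 :* (con 4 :* x)) :+ con 420 :* x := con 2 :* (con 14 :* (x :* con 16)) :+ con 5 :* (con 4 :* x)) refl (m G) ⟩
      2 * (14 * (m G * 16)) + 5 * (4 * m G)
        ≤⟨ +-mono-≤ (*-monoʳ-≤ 2 large) (≤-reflexive (cong (5 *_) (sym sizes))) ⟩
      2 * (covered S * 15) + 5 * (3 * Σ)
        ≡⟨ solve 2 (λ c s → con 2 :* (c :* con 15) :+ con 5 :* (con 3 :* s) := con 15 :* (con 2 :* c :+ s)) refl (covered S) Σ ⟩
      15 * (2 * covered S + Σ)
        ≤⟨ *-monoʳ-≤ 15 total ⟩
      15 * (m G * 28 + sum C)
        ≡⟨ solve 2 (λ x t → con 15 :* (x :* con 28 :+ t) := con 3 :* (con 5 :* t) :+ con 420 :* x) refl (m G) (sum C) ⟩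
      3 * (5 * sum C) + 420 * m G ∎
      where
      open ≤-Reasoning
      Σ = sum (λ i → count (restrict (S i)))

-- The lower bound 4/5

substitute : CubicBridgeless → CubicBridgeless
substitute H = record
  { graph      = substitution
  ; cubic      = substitution-cubic (cubic H)
  ; bridgeless = substitution-bridgeless (bridgeless H)
  ; nonempty   = m*n≢0 (m (graph H)) 16 {{nonempty H}}
  }
  where open Substitution (graph H)

lower-bound : (∀ H x → IsMt 4 H x → (+ 14 / 15) ℚ.≤ x) → ∀ H x → IsMt 3 H x → (+ 4 / 5) ℚ.≤ x
lower-bound m₄ H x ((Ms , pm , _) , max) = decidable-stable (_ ℚ.≤? x) λ x<4/5 →
  -- The climb starts from one perfect matching of `H`, extended to the substitution and taken four
  -- times.
  maximum-exists 4 (substitute H) (λ _ → extend (Ms 0F)) (λ _ → extend-perfect {Ms 0F} (pm 0F)) λ (y , isMax) →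
  x<4/5 (fromFour y isMax)
  where
  open Substitution (graph H)
  instance
    _ = nonempty H
    _ = nonempty (substitute H)
  fromFour : ∀ y → IsMt 4 (substitute H) y → (+ 4 / 5) ℚ.≤ x
  fromFour y isMax@((S , pmS , refl) , _) =
    let j , large = some-triple (graph H) (cubic H) S pmS (/-cancel-≤ 14 15 (covered S) (m (graph H) * 16) (m₄ (substitute H) y isMax))
        triple = λ i → restrict (S (punchIn j i))
    in ℚ.≤-trans
      (/-mono-≤ 4 5 (covered triple) (m (graph H)) (subst (4 * m (graph H) ≤_) (*-comm 5 (covered triple)) large))
      (max triple λ i → restrict-perfect {S (punchIn j i)} (pmS (punchIn j i)))

-- The Petersen graph attains 4/5

petersenGraph : CubicBridgeless
petersenGraph = record
  { graph = petersen ; cubic = petersen-cubic ; bridgeless = petersen-bridgeless ; nonempty = _ }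

petersen-m₃ : IsMt 3 petersenGraph (+ 4 / 5)
-- Rows 0, 1, 2 are distinct and cover 12 edges; 12/15 normalises to 4/5, hence `refl`.
petersen-m₃ = ((matching ∘ first3) , (λ i → matching-perfect (first3 i)) , refl) , bound
  where
  first3 : Fin 3 → Fin 6
  first3 i = i ↑ˡ 3
  bound : ∀ Ms → (∀ i → PerfectMatching petersen (Ms i)) → unionRatio petersenGraph 3 Ms ℚ.≤ (+ 4 / 5)
  bound Ms pm = /-mono-≤ (covered Ms) 15 4 5 (*-monoˡ-≤ 5 (subst (_≤ 12)
    (count-cong λ e → anyFin-cong λ i → sym (proj₂ (row i) e)) (threeMatchings≤12 (proj₁ ∘ row))))
    where
    row : ∀ i → ∃ λ r → Ms i ≗ matching r
    row i = petersenMatching-classification (Ms i) (pm i)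

theorem9 : MtEquals 4 (+ 14 / 15) → MtEquals 3 (+ 4 / 5)
-- The value 4/5 is attained, so one graph is a witness for every `q` above it.
theorem9 (m₄ , _) = lower-bound m₄ , λ q 4/5<q → petersenGraph , (+ 4 / 5) , petersen-m₃ , 4/5<q
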